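{- Let $G$ be a 2-connected series-parallel graph and $s,t$ distinct non-adjacent vertices of $G$. Any two $st$-separators $A,B$ of $G$ with $|A|=|B|$ can be reconfigured into each other under TJ.
   Context: A 2-connected graph $G$ is series-parallel if it is the simplification (keep one edge of each set of parallel edges) of a multigraph obtained from a single edge by repeatedly applying the series operation (subdivide an edge) and the parallel operation (replace an edge by two parallel copies of it). An $st$-separator is $S\subseteq V(G)\setminus\{s,t\}$ with $s,t$ in different components of $G-S$. Under TJ, separators $S,S'$ are adjacent if $|S|=|S'|$ and $|S\setminus S'|=|S'\setminus S|=1$; $A$ can be reconfigured into $B$ if there is a sequence of $st$-separators from $A$ to $B$ with consecutive sets adjacent. -}

module Defs where

open import Data.Nat using (ℕ; suc; _≤_)
open import Data.Fin using (Fin; zero; suc; inject₁; fromℕ)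
open import Data.Fin.Subset using (Subset; _∈_; _∉_; ⁅_⁆; _─_; ∣_∣)
open import Data.Product using (_×_; _,_; Σ)
import Data.Product as P
open import Data.Sum using (_⊎_)
open import Data.List using (List; []; _∷_; _++_; map)
open import Data.List.Membership.Propositional using () renaming (_∈_ to _∈ₗ_)
open import Relation.Nullary using (¬_)
open import Relation.Binary.PropositionalEquality using (_≡_)
open import Relation.Binary.Construct.Closure.ReflexiveTransitive using (Star)
open import Function.Bundles using (_⤖_; Bijection; _⇔_)

record Graph (n : ℕ) : Set₁ where
  field
    Adj     : Fin n → Fin n → Set
    sym     : ∀ {u v} → Adj u v → Adj v u
    irrefl  : ∀ {u} → ¬ Adj u u
open Graph public

_≅_ : ∀ {n m} → Graph n → Graph m → Set
_≅_ {n} {m} G H =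
  Σ (Fin n ⤖ Fin m) λ f →
    ∀ u v → Adj G u v ⇔ Adj H (Bijection.to f u) (Bijection.to f v)

data Reach {n} (G : Graph n) (S : Subset n) : Fin n → Fin n → Set where
  here : ∀ {x} → x ∉ S → Reach G S x x
  step : ∀ {x y z} → x ∉ S → Adj G x y → Reach G S y z → Reach G S x z

ConnectedAvoiding : ∀ {n} → Graph n → Subset n → Set
ConnectedAvoiding {n} G S = ∀ (u v : Fin n) → u ∉ S → v ∉ S → Reach G S u v

emptySet : ∀ {n} → Subset n
emptySet = Data.Fin.Subset.⊥

Connected : ∀ {n} → Graph n → Set
Connected G = ConnectedAvoiding G emptySet

TwoConnected : ∀ {n} → Graph n → Set
TwoConnected {n} G = (3 ≤ n) × Connected G × (∀ (x : Fin n) → ConnectedAvoiding G ⁅ x ⁆)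

Edge : ℕ → Set
Edge n = Fin n × Fin n

liftE : ∀ {n} → Edge n → Edge (suc n)
liftE = P.map inject₁ inject₁

data SPMulti : (n : ℕ) → List (Edge n) → Set where
  single   : SPMulti 2 ((zero , suc zero) ∷ [])
  series   : ∀ {n} xs ys (u v : Fin n) → SPMulti n (xs ++ (u , v) ∷ ys) →
             SPMulti (suc n) (map liftE xs ++ (inject₁ u , fromℕ n) ∷ (fromℕ n , inject₁ v) ∷ map liftE ys)
  parallel : ∀ {n} xs ys (e : Edge n) → SPMulti n (xs ++ e ∷ ys) →
             SPMulti n (xs ++ e ∷ e ∷ ys)

-- Simplification: u ~ v iff some multi-edge joins u and v.
-- (Constructed multigraphs have no loops, which is required as a proof.)
simplify : ∀ {n} (es : List (Edge n)) → (∀ {u} → ¬ ((u , u) ∈ₗ es)) → Graph n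
simplify es noLoop = record
  { Adj    = λ u v → ((u , v) ∈ₗ es) ⊎ ((v , u) ∈ₗ es)
  ; sym    = Data.Sum.swap
  ; irrefl = λ { (Data.Sum.inj₁ p) → noLoop p ; (Data.Sum.inj₂ p) → noLoop p }
  }

SeriesParallel : ∀ {n} → Graph n → Set
SeriesParallel G =
  Σ ℕ λ m → Σ (List (Edge m)) λ es → SPMulti m es × 
    Σ (∀ {u} → ¬ ((u , u) ∈ₗ es)) λ nl → G ≅ simplify es nl

IsSeparator : ∀ {n} → Graph n → Fin n → Fin n → Subset n → Set
IsSeparator G s t S = s ∉ S × t ∉ S × ¬ Reach G S s t

TJAdjacent : ∀ {n} → Subset n → Subset n → Set
TJAdjacent S S' = ∣ S ∣ ≡ ∣ S' ∣ × ∣ S ─ S' ∣ ≡ 1 × ∣ S' ─ S ∣ ≡ 1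

TJStep : ∀ {n} → Graph n → Fin n → Fin n → Subset n → Subset n → Set
TJStep G s t S S' = IsSeparator G s t S × IsSeparator G s t S' × TJAdjacent S S'

Reconfigurable : ∀ {n} → Graph n → Fin n → Fin n → Subset n → Subset n → Set
Reconfigurable G s t = Star (TJStep G s t)

{-# OPTIONS --safe #-}
module Submission where

-- Up to parallel edges, a series-parallel graph grows from an edge by repeatedly
-- adding a vertex w joined to both ends of an edge xy, which is then kept or removed.
-- By induction on this construction one follows separators between two terminals,
-- each of which is a vertex (closed to tokens) or an edge (both ends open to tokens).
-- A token on w can be moved to the smaller graph, unless the separator already
-- occupies every admissible vertex; a terminal that is the vertex w becomes the edge
-- xy, and a terminal edge at w becomes xy as well.  If one terminal is an edge, every
-- separator can be moved so as to occupy both ends of it (2-connectedness rules out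
-- that w carries the only token), and all other tokens are then free.  For two vertex
-- terminals s and t the induction ignores a possible edge st, since the smaller graph
-- contains that edge when w subdivides it.

open import Defs
open import Data.Nat using (ℕ; zero; suc; _≤_; _<_)
import Data.Nat.Properties as ℕ
open import Data.Fin using (Fin; zero; suc; inject₁; fromℕ)
open import Data.Fin.Properties using (_≟_; any?; inject₁-injective; fromℕ≢inject₁)
open import Data.Fin.Relation.Unary.Top using (view; ‵fromℕ; ‵inject₁)
open import Data.Fin.Subset using (Subset; inside; outside; _∈_; _∉_; _⊆_; _∪_; _─_; _-_; ⁅_⁆; ∣_∣)
open import Data.Fin.Subset.Properties using (_∈?_; ⊆-antisym; p⊂q⇒∣p∣<∣q∣; x∈⁅x⁆; x∈⁅y⁆⇒x≡y; x≢y⇒x∉⁅y⁆; ∣⁅x⁆∣≡1; x∈p∪q⁻; x∈p∪q⁺; p─q⊆p; x∈p∧x∉q⇒x∈p─q; x∈p∧x≢y⇒x∈p-y; ∪-identityʳ)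
open import Data.Vec using ([]; _∷_; here; there)
open import Data.Product using (Σ; ∃; ∃₂; _×_; _,_; proj₁; proj₂)
open import Data.Sum using (_⊎_; inj₁; inj₂; [_,_]′)
import Data.Sum as Sum
open import Data.Empty using (⊥)
open import Data.Unit using (⊤; tt)
open import Data.List using (List; _∷_; _++_; map)
open import Data.List.Membership.Propositional using () renaming (_∈_ to _∈ₗ_)
open import Data.List.Membership.Propositional.Properties using (∈-++⁻; ∈-++⁺ˡ; ∈-++⁺ʳ; ∈-map⁺; ∈-map⁻)
open import Data.List.Relation.Unary.Any using (here; there)
open import Relation.Nullary using (¬_; Dec; yes; no; contradiction)
open import Relation.Nullary.Decidable using (_×-dec_; _⊎-dec_; ¬?; map′)
open import Relation.Binary.PropositionalEquality using (_≡_; _≢_; refl; cong; subst; trans)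
import Relation.Binary.PropositionalEquality as ≡
open import Relation.Binary.Construct.Closure.ReflexiveTransitive using (Star; ε; _◅_; _◅◅_)
import Relation.Binary.Construct.Closure.ReflexiveTransitive as Star
open import Function.Bundles using (Bijection; Equivalence)

private
  variable
    N : ℕ
    a b c q w x z s t : Fin N
    S T A B C D : Subset N
    G G' : Graph N

-- Token jumps

x∈p─q⇒x∉q : ∀ (p q : Subset N) → x ∈ p ─ q → x ∉ q
x∈p─q⇒x∉q (_ ∷ p) (outside ∷ q) (there x∈) (there x∈q) = x∈p─q⇒x∉q p q x∈ x∈q
x∈p─q⇒x∉q (_ ∷ p) (inside ∷ q) (there x∈) (there x∈q) = x∈p─q⇒x∉q p q x∈ x∈q

∣p∪⁅x⁆∣≡1+∣p∣ : ∀ (p : Subset N) → x ∉ p → ∣ p ∪ ⁅ x ⁆ ∣ ≡ suc ∣ p ∣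
∣p∪⁅x⁆∣≡1+∣p∣ {x = zero} (inside ∷ p) x∉p = contradiction here x∉p
∣p∪⁅x⁆∣≡1+∣p∣ {x = zero} (outside ∷ p) x∉p = cong (λ r → suc ∣ r ∣) (∪-identityʳ p)
∣p∪⁅x⁆∣≡1+∣p∣ {x = suc x} (inside ∷ p) x∉p = cong suc (∣p∪⁅x⁆∣≡1+∣p∣ p (λ x∈ → x∉p (there x∈)))
∣p∪⁅x⁆∣≡1+∣p∣ {x = suc x} (outside ∷ p) x∉p = ∣p∪⁅x⁆∣≡1+∣p∣ p (λ x∈ → x∉p (there x∈))

∈-insert⁻ : ∀ (S : Subset N) → z ∈ S ∪ ⁅ b ⁆ → z ∈ S ⊎ z ≡ b
∈-insert⁻ {b = b} S z∈ = Sum.map₂ (x∈⁅y⁆⇒x≡y b) (x∈p∪q⁻ S _ z∈)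

∈-insertˡ : z ∈ S → z ∈ S ∪ ⁅ b ⁆
∈-insertˡ z∈S = x∈p∪q⁺ (inj₁ z∈S)

∈-insertʳ : ∀ (S : Subset N) → b ∈ S ∪ ⁅ b ⁆
∈-insertʳ {b = b} S = x∈p∪q⁺ {p = S} (inj₂ (x∈⁅x⁆ b))

∈-remove⁻ : ∀ (S : Subset N) → z ∈ S - a → z ∈ S × z ≢ a
∈-remove⁻ {a = a} S z∈ =
  p─q⊆p S _ z∈ , λ { refl → x∈p─q⇒x∉q S ⁅ a ⁆ z∈ (x∈⁅x⁆ a) }

x∉p-x : ∀ (S : Subset N) → a ∉ S - a
x∉p-x S a∈ = proj₂ (∈-remove⁻ S a∈) refl

remove-insert : ∀ (S : Subset N) → a ∈ S → (S - a) ∪ ⁅ a ⁆ ≡ S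
remove-insert {a = a} S a∈S = ⊆-antisym to from
  where
  to : (S - a) ∪ ⁅ a ⁆ ⊆ S
  to z∈ with ∈-insert⁻ (S - a) z∈
  ... | inj₁ z∈- = proj₁ (∈-remove⁻ S z∈-)
  ... | inj₂ refl = a∈S
  from : S ⊆ (S - a) ∪ ⁅ a ⁆
  from {z} z∈S with z ≟ a
  ... | yes refl = ∈-insertʳ (S - a)
  ... | no z≢a = ∈-insertˡ (x∈p∧x≢y⇒x∈p-y z∈S z≢a)

∣p∣≡1+∣p-x∣ : ∀ (S : Subset N) → a ∈ S → ∣ S ∣ ≡ suc ∣ S - a ∣
∣p∣≡1+∣p-x∣ {a = a} S a∈S =
  trans (cong ∣_∣ (≡.sym (remove-insert S a∈S))) (∣p∪⁅x⁆∣≡1+∣p∣ (S - a) (x∉p-x S))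

⊆∧∣∣≡⇒≡ : S ⊆ T → ∣ S ∣ ≡ ∣ T ∣ → S ≡ T
⊆∧∣∣≡⇒≡ {S = S} {T = T} S⊆T eq = ⊆-antisym S⊆T T⊆S
  where
  T⊆S : T ⊆ S
  T⊆S {z} z∈T with z ∈? S
  ... | yes z∈S = z∈S
  ... | no z∉S = contradiction (p⊂q⇒∣p∣<∣q∣ (S⊆T , z , z∈T , z∉S)) (ℕ.<-irrefl eq)

jump : Subset N → Fin N → Fin N → Subset N
jump S a b = (S - a) ∪ ⁅ b ⁆

∈-jump⁻ : z ∈ jump S a b → (z ∈ S × z ≢ a) ⊎ z ≡ b
∈-jump⁻ {S = S} {a = a} z∈ = Sum.map₁ (∈-remove⁻ S) (∈-insert⁻ (S - a) z∈)

∈-jumpˡ : z ∈ S → z ≢ a → z ∈ jump S a b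
∈-jumpˡ z∈S z≢a = ∈-insertˡ (x∈p∧x≢y⇒x∈p-y z∈S z≢a)

∈-jumpʳ : ∀ (S : Subset N) a b → b ∈ jump S a b
∈-jumpʳ S a b = ∈-insertʳ (S - a)

jump-adjacent : a ∈ S → b ∉ S → TJAdjacent S (jump S a b)
jump-adjacent {a = a} {S = S} {b = b} a∈S b∉S =
  ≡.sym size , trans (cong ∣_∣ lost) (∣⁅x⁆∣≡1 a) , trans (cong ∣_∣ gained) (∣⁅x⁆∣≡1 b)
  where
  size : ∣ jump S a b ∣ ≡ ∣ S ∣
  size = trans (∣p∪⁅x⁆∣≡1+∣p∣ (S - a) (λ b∈ → b∉S (proj₁ (∈-remove⁻ S b∈))))
               (≡.sym (∣p∣≡1+∣p-x∣ S a∈S))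

  a∉ : a ∉ jump S a b
  a∉ a∈ with ∈-jump⁻ a∈
  ... | inj₁ (_ , a≢a) = a≢a refl
  ... | inj₂ refl = b∉S a∈S

  lost : S ─ jump S a b ≡ ⁅ a ⁆
  lost = ⊆-antisym to from
    where
    to : S ─ jump S a b ⊆ ⁅ a ⁆
    to {z} z∈ with z ≟ a
    ... | yes refl = x∈⁅x⁆ a
    ... | no z≢a = contradiction (∈-jumpˡ (p─q⊆p S _ z∈) z≢a) (x∈p─q⇒x∉q S _ z∈)
    from : ⁅ a ⁆ ⊆ S ─ jump S a b
    from z∈ with refl ← x∈⁅y⁆⇒x≡y a z∈ = x∈p∧x∉q⇒x∈p─q a∈S a∉

  gained : jump S a b ─ S ≡ ⁅ b ⁆
  gained = ⊆-antisym to from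
    where
    to : jump S a b ─ S ⊆ ⁅ b ⁆
    to z∈ with ∈-jump⁻ (p─q⊆p (jump S a b) S z∈)
    ... | inj₁ (z∈S , _) = contradiction z∈S (x∈p─q⇒x∉q (jump S a b) S z∈)
    ... | inj₂ refl = x∈⁅x⁆ b
    from : ⁅ b ⁆ ⊆ jump S a b ─ S
    from z∈ with refl ← x∈⁅y⁆⇒x≡y b z∈ = x∈p∧x∉q⇒x∈p─q (∈-jumpʳ S a b) b∉S

insert-adjacent : w ∉ S → w ∉ T → TJAdjacent S T → TJAdjacent (S ∪ ⁅ w ⁆) (T ∪ ⁅ w ⁆)
insert-adjacent {w = w} w∉S w∉T (eq , ST , TS) =
  trans (∣p∪⁅x⁆∣≡1+∣p∣ _ w∉S) (trans (cong suc eq) (≡.sym (∣p∪⁅x⁆∣≡1+∣p∣ _ w∉T))) ,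
  trans (cong ∣_∣ (diff w∉S)) ST , trans (cong ∣_∣ (diff w∉T)) TS
  where
  diff : ∀ {S T} → w ∉ S → (S ∪ ⁅ w ⁆) ─ (T ∪ ⁅ w ⁆) ≡ S ─ T
  diff {S} {T} w∉S = ⊆-antisym to from
    where
    to : (S ∪ ⁅ w ⁆) ─ (T ∪ ⁅ w ⁆) ⊆ S ─ T
    to z∈ with ∈-insert⁻ S (p─q⊆p (S ∪ ⁅ w ⁆) _ z∈)
    ... | inj₁ z∈S = x∈p∧x∉q⇒x∈p─q z∈S (λ z∈T → x∈p─q⇒x∉q (S ∪ ⁅ w ⁆) _ z∈ (∈-insertˡ z∈T))
    ... | inj₂ refl = contradiction (∈-insertʳ T) (x∈p─q⇒x∉q (S ∪ ⁅ w ⁆) _ z∈)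
    from : S ─ T ⊆ (S ∪ ⁅ w ⁆) ─ (T ∪ ⁅ w ⁆)
    from {z} z∈ = x∈p∧x∉q⇒x∈p─q (∈-insertˡ z∈S) λ z∈' →
      [ x∈p─q⇒x∉q S T z∈ , (λ { refl → w∉S z∈S }) ]′ (∈-insert⁻ T z∈')
      where
      z∈S : z ∈ S
      z∈S = p─q⊆p S T z∈

Step : (Subset N → Set) → Subset N → Subset N → Set
Step P S S' = P S × P S' × TJAdjacent S S'

_⊢_↝_ : (Subset N → Set) → Subset N → Subset N → Set
P ⊢ S ↝ T = Star (Step P) S T

infix 3 _⊢_↝_

map-↝ : ∀ {P P' : Subset N → Set} → (∀ {S} → P S → P' S) → P ⊢ S ↝ T → P' ⊢ S ↝ T
map-↝ f = Star.map λ (pS , pT , adj) → f pS , f pT , adj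

sym-↝ : ∀ {P : Subset N → Set} → P ⊢ S ↝ T → P ⊢ T ↝ S
sym-↝ = Star.reverse λ (pS , pT , eq , ST , TS) → pT , pS , ≡.sym eq , TS , ST

↝-∣∣ : ∀ {P : Subset N → Set} → P ⊢ S ↝ T → ∣ S ∣ ≡ ∣ T ∣
↝-∣∣ ε = refl
↝-∣∣ ((_ , _ , eq , _) ◅ r) = trans eq (↝-∣∣ r)

jump-↝ : ∀ {P : Subset N → Set} → a ∈ S → b ∉ S → P S → P (jump S a b) → P ⊢ S ↝ jump S a b
jump-↝ a∈S b∉S pS pT = (pS , pT , jump-adjacent a∈S b∉S) ◅ ε

-- Exchanging a vertex of `C` outside `D` for one of `D` outside `C` stays between the intersection
-- and the union and comes closer to `D`. This joins configurations whose validity is guaranteed by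
-- a common set of occupied vertices.
interval-↝ : ∀ {P : Subset N → Set} (C D : Subset N) → ∣ C ∣ ≡ ∣ D ∣ →
  (∀ {S} → (∀ {z} → z ∈ C → z ∈ D → z ∈ S) → (∀ {z} → z ∈ S → z ∈ C ⊎ z ∈ D) → P S) →
  P ⊢ C ↝ D
interval-↝ {P = P} C D = go _ C ℕ.≤-refl
  where
  go : ∀ k C → ∣ C ─ D ∣ ≤ k → ∣ C ∣ ≡ ∣ D ∣ →
    (∀ {S} → (∀ {z} → z ∈ C → z ∈ D → z ∈ S) → (∀ {z} → z ∈ S → z ∈ C ⊎ z ∈ D) → P S) →
    P ⊢ C ↝ D
  go k C le eq between with any? (λ z → (z ∈? C) ×-dec ¬? (z ∈? D))
  ... | no ¬c = subst (P ⊢ C ↝_) (⊆∧∣∣≡⇒≡ C⊆D eq) ε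
    where
    C⊆D : C ⊆ D
    C⊆D {z} z∈C with z ∈? D
    ... | yes z∈D = z∈D
    ... | no z∉D = contradiction (z , z∈C , z∉D) ¬c
  ... | yes (c , c∈C , c∉D) with any? (λ z → (z ∈? D) ×-dec ¬? (z ∈? C))
  ...   | no ¬d = contradiction (p⊂q⇒∣p∣<∣q∣ (D⊆C , c , c∈C , c∉D)) (ℕ.<-irrefl (≡.sym eq))
    where
    D⊆C : D ⊆ C
    D⊆C {z} z∈D with z ∈? C
    ... | yes z∈C = z∈C
    ... | no z∉C = contradiction (z , z∈D , z∉C) ¬d
  ...   | yes (d , d∈D , d∉C) = closer k le
    where
    C₁ = jump C c d

    C₁⊆ : ∀ {z} → z ∈ C₁ → z ∈ C ⊎ z ∈ D
    C₁⊆ z∈ with ∈-jump⁻ z∈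
    ... | inj₁ (z∈C , _) = inj₁ z∈C
    ... | inj₂ refl = inj₂ d∈D

    C∩D⊆C₁ : ∀ {z} → z ∈ C → z ∈ D → z ∈ C₁
    C∩D⊆C₁ z∈C z∈D = ∈-jumpˡ z∈C λ { refl → c∉D z∈D }

    decrease : ∣ C₁ ─ D ∣ < ∣ C ─ D ∣
    decrease = p⊂q⇒∣p∣<∣q∣ (sub , c , x∈p∧x∉q⇒x∈p─q c∈C c∉D , c∉)
      where
      sub : C₁ ─ D ⊆ C ─ D
      sub z∈ with C₁⊆ (p─q⊆p C₁ D z∈)
      ... | inj₁ z∈C = x∈p∧x∉q⇒x∈p─q z∈C (x∈p─q⇒x∉q C₁ D z∈)
      ... | inj₂ z∈D = contradiction z∈D (x∈p─q⇒x∉q C₁ D z∈)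
      c∉ : c ∉ C₁ ─ D
      c∉ c∈ with ∈-jump⁻ (p─q⊆p C₁ D c∈)
      ... | inj₁ (_ , c≢c) = c≢c refl
      ... | inj₂ refl = d∉C c∈C

    first : P ⊢ C ↝ C₁
    first = jump-↝ c∈C d∉C (between (λ z∈C _ → z∈C) inj₁) (between C∩D⊆C₁ C₁⊆)

    -- The bound `k` is inspected only once `decrease` is known: zero is then impossible, and
    -- otherwise the bound drops by one.
    closer : ∀ k → ∣ C ─ D ∣ ≤ k → P ⊢ C ↝ D
    closer zero le = contradiction (ℕ.<-≤-trans decrease le) λ ()
    closer (suc k) le = first ◅◅ go k C₁ (ℕ.≤-pred (ℕ.≤-trans decrease le)) (trans (≡.sym (↝-∣∣ first)) eq)
      (λ low high → between (λ z∈C z∈D → low (C∩D⊆C₁ z∈C z∈D) z∈D)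
                            (λ z∈ → [ C₁⊆ , inj₂ ]′ (high z∈)))

-- Separators between vertex sets

head-∉ : Reach G S a b → a ∉ S
head-∉ (here a∉S) = a∉S
head-∉ (step a∉S _ _) = a∉S

snoc : Reach G S a b → Adj G b c → c ∉ S → Reach G S a c
snoc (here a∉S) bc c∉S = step a∉S bc (here c∉S)
snoc (step a∉S ab r) bc c∉S = step a∉S ab (snoc r bc c∉S)

last-∉ : Reach G S a b → b ∉ S
last-∉ (here a∉S) = a∉S
last-∉ (step _ _ r) = last-∉ r

reverse : Reach G S a b → Reach G S b a
reverse (here a∉S) = here a∉S
reverse {G = G} (step a∉S ab r) = snoc (reverse r) (sym G ab) a∉S

map-Reach : (∀ {u v} → Adj G u v → Adj G' u v) → (∀ {v} → v ∈ T → v ∈ S) →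
  Reach G S a b → Reach G' T a b
map-Reach f g (here a∉S) = here (λ a∈T → a∉S (g a∈T))
map-Reach f g (step a∉S ab r) = step (λ a∈T → a∉S (g a∈T)) (f ab) (map-Reach f g r)

VertexSet : ℕ → Set₁
VertexSet N = Fin N → Set

Pair : Fin N → Fin N → VertexSet N
Pair u v z = z ≡ u ⊎ z ≡ v

Joins : Fin N → Fin N → Fin N → Fin N → Set
Joins u v a b = (a ≡ u × b ≡ v) ⊎ (a ≡ v × b ≡ u)

∅ : VertexSet N
∅ _ = ⊥

-- U is the vertex set of G, and F consists of vertices that may not carry tokens.
-- Vertices of P and Q themselves may belong to S unless they are in F.
record Separates (U : VertexSet N) (G : Graph N) (P Q F : VertexSet N) (S : Subset N) : Set where
  constructor separates
  field
    within : ∀ {z} → z ∈ S → U z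
    avoids : ∀ {z} → z ∈ S → ¬ F z
    cuts   : ∀ {p q} → P p → Q q → ¬ Reach G S p q

open Separates

-- A set with `P` occupied serves as a normal form: it separates because no walk can start in `P`,
-- so the remaining tokens may be placed anywhere in `U` off `F`.
record Gathers (U : VertexSet N) (G : Graph N) (P Q F : VertexSet N) (S : Subset N) : Set where
  constructor gathers
  field
    target    : Subset N
    valid     : Separates U G P Q F target
    path      : Separates U G P Q F ⊢ S ↝ target
    occupied  : ∀ {p} → P p → p ∈ target

private
  variable
    U U' P P' Q Q' F F' : VertexSet N

occupied-separates : (∀ {v} → v ∈ S → U v) → (∀ {v} → v ∈ S → ¬ F v) → (∀ {p} → P p → p ∈ S) →
  Separates U G P Q F S
occupied-separates within avoids P⊆S =
  separates within avoids (λ Pp _ r → head-∉ r (P⊆S Pp))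

jump-within : Separates U G P Q F S → U b → ∀ {z} → z ∈ jump S a b → U z
jump-within sep Ub z∈ with ∈-jump⁻ z∈
... | inj₁ (z∈S , _) = within sep z∈S
... | inj₂ refl = Ub

jump-avoids : Separates U G P Q F S → ¬ F b → ∀ {z} → z ∈ jump S a b → ¬ F z
jump-avoids sep ¬Fb z∈ with ∈-jump⁻ z∈
... | inj₁ (z∈S , _) = avoids sep z∈S
... | inj₂ refl = ¬Fb

jump-gathers : Separates U G P Q F S → a ∈ S → b ∉ S → U b → ¬ F b →
  (∀ {p} → P p → p ∈ jump S a b) → Gathers U G P Q F S
jump-gathers {S = S} {a = a} {b = b} sep a∈S b∉S Ub ¬Fb P⊆ =
  gathers (jump S a b) sep' (jump-↝ a∈S b∉S sep sep') P⊆
  where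
  sep' = occupied-separates (jump-within sep Ub) (jump-avoids sep ¬Fb) P⊆

-- S cannot be {w}, so some other token can jump to c.
fill-gathers : Separates U G P Q F S → (∀ {p} → P p → Pair w c p) → P c → U c → ¬ F c →
  w ∈ S → Q q → Reach G ⁅ w ⁆ c q → Gathers U G P Q F S
fill-gathers {P = P} {S = S} {w = w} {c = c} sep P⊆ Pc Uc ¬Fc w∈S Qq r with c ∈? S
... | yes c∈S = gathers S sep ε occ
  where
  occ : ∀ {p} → P p → p ∈ S
  occ Pp with P⊆ Pp
  ... | inj₁ refl = w∈S
  ... | inj₂ refl = c∈S
... | no c∉S with any? (λ z → (z ∈? S) ×-dec ¬? (z ≟ w))
...   | yes (a , a∈S , a≢w) = jump-gathers sep a∈S c∉S Uc ¬Fc occ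
  where
  occ : ∀ {p} → P p → p ∈ jump S a c
  occ Pp with P⊆ Pp
  ... | inj₁ refl = ∈-jumpˡ w∈S (λ w≡a → a≢w (≡.sym w≡a))
  ... | inj₂ refl = ∈-jumpʳ S a c
...   | no none = contradiction (map-Reach (λ e → e) S⊆⁅w⁆ r) (cuts sep Pc Qq)
  where
  S⊆⁅w⁆ : ∀ {z} → z ∈ S → z ∈ ⁅ w ⁆
  S⊆⁅w⁆ {z} z∈S with z ≟ w
  ... | yes refl = x∈⁅x⁆ w
  ... | no z≢w = contradiction (z , z∈S , z≢w) none

Full : VertexSet N → VertexSet N → Subset N → Set
Full U F S = ∀ v → U v → F v ⊎ v ∈ S

-- Tokens of a separator lie in `U` and off `F`, so it is contained in a full set, and equal sizes
-- force equality. When the token on `w` has nowhere to go, nothing is left to reconfigure.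
full-unique : Full U F A → Separates U G P Q F B → ∣ B ∣ ≡ ∣ A ∣ → B ≡ A
full-unique full sep = ⊆∧∣∣≡⇒≡ λ z∈B →
  [ (λ Fz → contradiction Fz (avoids sep z∈B)) , (λ z∈A → z∈A) ]′ (full _ (within sep z∈B))

-- Series-parallel graphs

-- G arises from G' by adding a vertex w joined to both ends of an edge xy,
-- the edge xy itself being either kept or removed.
record Extends (U' : VertexSet N) (G' : Graph N) (U : VertexSet N) (G : Graph N) (x y w : Fin N) : Set where
  field
    w∉U'   : ¬ U' w
    U'⊆U   : ∀ {z} → U' z → U z
    w∈U    : U w
    U⊆U'∪w : ∀ {z} → U z → U' z ⊎ z ≡ w
    ends   : ∀ {a b} → Adj G' a b → U' a
    xy     : Adj G' x y
    xw     : Adj G x w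
    yw     : Adj G y w
    down   : ∀ {a b} → Adj G a b → Adj G' a b ⊎ (a ≡ w × Pair x y b) ⊎ (b ≡ w × Pair x y a)
    up     : ∀ {a b} → Adj G' a b → Adj G a b ⊎ Joins x y a b

flip : ∀ {x y w : Fin N} → Extends U' G' U G x y w → Extends U' G' U G y x w
flip {G' = G'} E = record
  { w∉U' = w∉U' ; U'⊆U = U'⊆U ; w∈U = w∈U ; U⊆U'∪w = U⊆U'∪w ; ends = ends
  ; xy = sym G' xy ; xw = yw ; yw = xw
  ; down = λ e → Sum.map₂ (Sum.map (λ (p , q) → p , Sum.swap q) (λ (p , q) → p , Sum.swap q)) (down e)
  ; up = λ e → Sum.map₂ Sum.swap (up e)
  }
  where open Extends E

data Built {N} : VertexSet N → Graph N → Set₁ where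
  base : ∀ {U G} (a b : Fin N) → U a → U b → (∀ {z} → U z → Pair a b z) →
         (∀ {u v} → Adj G u v → Joins a b u v) → Built U G
  ext  : ∀ {U' G' U G} {x y w : Fin N} → Built U' G' → Extends U' G' U G x y w → Built U G

-- `U` is a mere predicate, but `reduce` has to search it for an unoccupied vertex.
Built-dec : Built U G → ∀ z → Dec (U z)
Built-dec (base a b Ua Ub U⊆ _) z =
  map′ [ (λ { refl → Ua }) , (λ { refl → Ub }) ]′ U⊆ ((z ≟ a) ⊎-dec (z ≟ b))
Built-dec (ext {w = w} B E) z =
  map′ [ U'⊆U , (λ { refl → w∈U }) ]′ U⊆U'∪w (Built-dec B z ⊎-dec (z ≟ w))
  where open Extends E

Biconnected : VertexSet N → Graph N → Set
Biconnected U G = ∀ c {a b} → U a → U b → a ≢ c → b ≢ c → Reach G ⁅ c ⁆ a b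

record IsEdge (G : Graph N) (P : VertexSet N) : Set where
  constructor isEdge
  field
    {u v} : Fin N
    adj   : Adj G u v
    P⊆    : ∀ {p} → P p → Pair u v p
    ⊆P    : ∀ {p} → Pair u v p → P p

-- Walks and separators across one extension

module Extension {U' : VertexSet N} {G' U G} {x y w : Fin N} (E : Extends U' G' U G x y w) where
  open Extends E public

  U'⇒≢w : ∀ {z} → U' z → z ≢ w
  U'⇒≢w Uz refl = w∉U' Uz

  U≢w⇒U' : ∀ {z} → U z → z ≢ w → U' z
  U≢w⇒U' Uz z≢w = [ (λ U'z → U'z) , (λ z≡w → contradiction z≡w z≢w) ]′ (U⊆U'∪w Uz)

  ends' : ∀ {a b} → Adj G' a b → U' b
  ends' e = ends (sym G' e)

  pair⊆U' : ∀ {z} → Pair x y z → U' z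
  pair⊆U' (inj₁ refl) = ends xy
  pair⊆U' (inj₂ refl) = ends' xy

  x≢y : x ≢ y
  x≢y refl = irrefl G' xy

  pair~w : ∀ {z} → Pair x y z → Adj G z w
  pair~w (inj₁ refl) = xw
  pair~w (inj₂ refl) = yw

  -- A passage through `w` enters and leaves by ends of `xy`, and in `G'` that edge replaces it. The
  -- second component treats walks starting at `w`, which the recursion meets.
  project-both : Reach G S a b → b ≢ w →
    (a ≢ w → Reach G' S a b) × (a ≡ w → Reach G' S x b ⊎ Reach G' S y b)
  project-both (here a∉S) b≢w = (λ _ → here a∉S) , (λ b≡w → contradiction b≡w b≢w)
  project-both (step a∉S ac r) b≢w with down ac | project-both r b≢w
  ... | inj₁ ac' | rec , _ =
        (λ _ → step a∉S ac' (rec (U'⇒≢w (ends' ac')))) , (λ a≡w → contradiction a≡w (U'⇒≢w (ends ac')))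
  ... | inj₂ (inj₁ (refl , inj₁ refl)) | rec , _ =
        (λ w≢w → contradiction refl w≢w) , (λ _ → inj₁ (rec (U'⇒≢w (ends xy))))
  ... | inj₂ (inj₁ (refl , inj₂ refl)) | rec , _ =
        (λ w≢w → contradiction refl w≢w) , (λ _ → inj₂ (rec (U'⇒≢w (ends' xy))))
  ... | inj₂ (inj₂ (refl , inj₁ refl)) | _ , rec =
        (λ _ → [ (λ r' → r') , step a∉S xy ]′ (rec refl)) , (λ x≡w → contradiction x≡w (U'⇒≢w (ends xy)))
  ... | inj₂ (inj₂ (refl , inj₂ refl)) | _ , rec =
        (λ _ → [ step a∉S (sym G' xy) , (λ r' → r') ]′ (rec refl)) , (λ y≡w → contradiction y≡w (U'⇒≢w (ends' xy)))

  project : a ≢ w → b ≢ w → Reach G S a b → Reach G' S a b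
  project a≢w b≢w r = proj₁ (project-both r b≢w) a≢w

  project-from-w : b ≢ w → Reach G S w b → Reach G' S x b ⊎ Reach G' S y b
  project-from-w b≢w r = proj₂ (project-both r b≢w) refl

  -- The only edge of `G'` that can be missing from `G` is `xy`, and the path through the unoccupied
  -- `w` replaces it.
  lift : w ∉ S → Reach G' S a b → Reach G S a b
  lift w∉S (here a∉S) = here a∉S
  lift w∉S (step a∉S ac r) with up ac
  ... | inj₁ ac' = step a∉S ac' (lift w∉S r)
  ... | inj₂ (inj₁ (refl , refl)) = step a∉S xw (step w∉S (sym G yw) (lift w∉S r))
  ... | inj₂ (inj₂ (refl , refl)) = step a∉S yw (step w∉S (sym G xw) (lift w∉S r))

  -- Walks avoiding an end of xy do not need that edge, so w may be occupied.
  lift-around : ∀ {z} → (∀ {v} → v ∈ S → v ≢ w → v ∈ T) → Pair x y z → z ∈ T →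
    a ≢ w → Reach G' T a b → Reach G S a b
  lift-around S⊆T _ z∈T a≢w (here a∉T) = here (λ a∈S → a∉T (S⊆T a∈S a≢w))
  lift-around S⊆T z∈xy z∈T a≢w (step a∉T ac r) with up ac
  ... | inj₁ ac' = step (λ a∈S → a∉T (S⊆T a∈S a≢w)) ac' (lift-around S⊆T z∈xy z∈T (U'⇒≢w (ends' ac)) r)
  ... | inj₂ (inj₁ (refl , refl)) =
        contradiction z∈T ([ (λ { refl → a∉T }) , (λ { refl → head-∉ r }) ]′ z∈xy)
  ... | inj₂ (inj₂ (refl , refl)) =
        contradiction z∈T ([ (λ { refl → head-∉ r }) , (λ { refl → a∉T }) ]′ z∈xy)

  biconnected : Biconnected U G → Biconnected U' G'
  biconnected bi c Ua Ub a≢c b≢c =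
    project (U'⇒≢w Ua) (U'⇒≢w Ub) (bi c (U'⊆U Ua) (U'⊆U Ub) a≢c b≢c)

  -- Needed to carry a cut from `G'` to `G`: a walk leaving `w` may enter the old part at either end
  -- of `xy`, so both ends must be terminals if `w` is one.
  Covers : VertexSet N → VertexSet N → Set
  Covers P P' = ∀ {p} → P p → (p ≡ w × P' x × P' y) ⊎ (p ≢ w × P' p)

  -- Needed to carry a cut from `G` to `G'`: a terminal vertex gained must be a neighbour of a
  -- terminal `w`, so that walks can be prolonged to `w`.
  Reflects : VertexSet N → VertexSet N → Set
  Reflects P P' = ∀ {p} → P' p → P p ⊎ (P w × Pair x y p)

  old-covers : (∀ {p} → P p → U' p) → Covers P P
  old-covers P⊆U' Pp = inj₂ (U'⇒≢w (P⊆U' Pp) , Pp)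

  -- A walk violating the cut in `G` projects to `G'`, with `x` or `y` standing in for an end at
  -- `w`. `¬PQ` excludes walks from `w` back to itself. Tokens of `G'` never sit on `w`, so `F'` may
  -- omit it.
  raise : Covers P P' → Covers Q Q' → ¬ (P w × Q w) → (∀ {z} → F z → z ≢ w → F' z) →
    Separates U' G' P' Q' F' S → Separates U G P Q F S
  raise {P = P} {Q = Q} {S = S} covP covQ ¬PQ F⊆ sep = separates
    (λ z∈S → U'⊆U (within sep z∈S))
    (λ z∈S Fz → avoids sep z∈S (F⊆ Fz (U'⇒≢w (within sep z∈S))))
    cut
    where
    cut : ∀ {p q} → P p → Q q → ¬ Reach G S p q
    cut Pp Qq r with covP Pp | covQ Qq
    ... | inj₁ (refl , _ , _) | inj₁ (refl , _ , _) = ¬PQ (Pp , Qq)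
    ... | inj₁ (refl , P'x , P'y) | inj₂ (q≢w , Q'q) =
          [ cuts sep P'x Q'q , cuts sep P'y Q'q ]′ (project-from-w q≢w r)
    ... | inj₂ (p≢w , P'p) | inj₁ (refl , Q'x , Q'y) =
          [ (λ r' → cuts sep P'p Q'x (reverse r')) , (λ r' → cuts sep P'p Q'y (reverse r')) ]′
            (project-from-w p≢w (reverse r))
    ... | inj₂ (p≢w , P'p) | inj₂ (q≢w , Q'q) = cuts sep P'p Q'q (project p≢w q≢w r)

  attach : Reflects P P' → w ∉ S → ∀ {p b} → P' p → Reach G S p b → ∃ λ p₀ → P p₀ × Reach G S p₀ b
  attach refP w∉S P'p r with refP P'p
  ... | inj₁ Pp = _ , Pp , r
  ... | inj₂ (Pw , p∈xy) = w , Pw , step w∉S (sym G (pair~w p∈xy)) r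

  -- A walk of `G'` is lifted through the unoccupied `w`, and `attach` prolongs it to `w` at an end
  -- that is not already a terminal vertex in `G`.
  restrict : Reflects P P' → Reflects Q Q' → (∀ {z} → F' z → F z) → w ∉ S →
    Separates U G P Q F S → Separates U' G' P' Q' F' S
  restrict refP refQ F'⊆F w∉S sep = separates
    (λ z∈S → U≢w⇒U' (within sep z∈S) (λ { refl → w∉S z∈S }))
    (λ z∈S F'z → avoids sep z∈S (F'⊆F F'z))
    (λ P'p Q'q r →
      let p₀ , Pp₀ , r₁ = attach refP w∉S P'p (lift w∉S r)
          q₀ , Qq₀ , r₂ = attach refQ w∉S Q'q (reverse r₁)
      in cuts sep Pp₀ Qq₀ (reverse r₂))

  -- z is the end of xy that has to be occupied whenever w is.
  record Transfers (z : Fin N) (P P' : VertexSet N) : Set where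
    constructor transfers
    field
      covers   : Covers P P'
      reflects : ∀ {p} → P' p → P p ⊎ (P w × p ≡ z)
      inner    : ∀ {p} → P' p → U' p

  open Transfers public

  old-transfers : ∀ {z} → (∀ {p} → P p → U' p) → Transfers z P P
  old-transfers P⊆U' = transfers (old-covers P⊆U') inj₁ P⊆U'

  -- The terminal edge `wx` turns into `xy`. The vertex gained is `y`, hence `y` is the end that
  -- must be occupied.
  new-transfers : (∀ {p} → P p → Pair w x p) → (∀ {p} → Pair w x p → P p) → Transfers y P (Pair x y)
  new-transfers {P = P} P⊆ ⊆P = transfers cov ref pair⊆U'
    where
    cov : Covers P (Pair x y)
    cov Pp with P⊆ Pp
    ... | inj₁ refl = inj₁ (refl , inj₁ refl , inj₂ refl)
    ... | inj₂ refl = inj₂ (U'⇒≢w (ends xy) , inj₁ refl)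
    ref : ∀ {p} → Pair x y p → P p ⊎ (P w × p ≡ y)
    ref (inj₁ refl) = inj₁ (⊆P (inj₂ refl))
    ref (inj₂ refl) = inj₂ (⊆P (inj₁ refl) , refl)

  Reduct : (P Q P' Q' F : VertexSet N) → Subset N → Set
  Reduct P Q P' Q' F S = ∃ λ T → Separates U' G' P' Q' F T × (Separates U G P Q F ⊢ S ↝ T)

  -- A token on `w` goes to `z` or, if `z` already holds a token, to any admissible vertex of `G'`.
  -- Either way `z` ends up occupied, so walks of `G'` avoiding the new set do not use `xy` and
  -- yield walks of `G` avoiding `S`. If no admissible vertex is left, `S` is full.
  reduce : (∀ z → Dec (U' z)) → (∀ z → Dec (F z)) → ∀ z → Pair x y z → ¬ F z →
    Transfers z P P' → Transfers z Q Q' → ¬ (P w × Q w) → Separates U G P Q F S →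
    Reduct P Q P' Q' F S ⊎ Full U F S
  reduce {F = F} {P = P} {P' = P'} {Q = Q} {Q' = Q'} {S = S} U'? F? z z∈xy ¬Fz tP tQ ¬PQ sep with w ∈? S
  ... | no w∉S = inj₁ (S , restrict (refl' tP) (refl' tQ) (λ Fv → Fv) w∉S sep , ε)
    where
    refl' : ∀ {P P'} → Transfers z P P' → Reflects P P'
    refl' t P'p with reflects t P'p
    ... | inj₁ Pp = inj₁ Pp
    ... | inj₂ (Pw , refl) = inj₂ (Pw , z∈xy)
  ... | yes w∈S = moveOff
    where
    move : ∀ {v} → U' v → ¬ F v → v ∉ S → z ∈ jump S w v → Reduct P Q P' Q' F S
    move {v} U'v ¬Fv v∉S z∈T =
      jump S w v , sep' , jump-↝ w∈S v∉S sep (raise (covers tP) (covers tQ) ¬PQ (λ Fv _ → Fv) sep')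
      where
      -- The only terminal vertex that may have been gained is `z`, which is occupied and hence lies
      -- on no walk.
      P'⇒P : ∀ {P P' p} → Transfers z P P' → P' p → p ∉ jump S w v → P p
      P'⇒P t P'p p∉ with reflects t P'p
      ... | inj₁ Pp = Pp
      ... | inj₂ (_ , refl) = contradiction z∈T p∉
      within' : ∀ {u} → u ∈ jump S w v → U' u
      within' u∈ with ∈-jump⁻ u∈
      ... | inj₁ (u∈S , u≢w) = U≢w⇒U' (within sep u∈S) u≢w
      ... | inj₂ refl = U'v
      sep' : Separates U' G' P' Q' F (jump S w v)
      sep' = separates within' (jump-avoids sep ¬Fv) λ P'p Q'q r →
        cuts sep (P'⇒P tP P'p (head-∉ r)) (P'⇒P tQ Q'q (last-∉ r))
          (lift-around ∈-jumpˡ z∈xy z∈T (U'⇒≢w (inner tP P'p)) r)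

    moveOff : Reduct P Q P' Q' F S ⊎ Full U F S
    moveOff with z ∈? S
    ... | no z∉S = inj₁ (move (pair⊆U' z∈xy) ¬Fz z∉S (∈-jumpʳ S w z))
    ... | yes z∈S with any? (λ v → U'? v ×-dec ¬? (F? v) ×-dec ¬? (v ∈? S))
    ...   | yes (v , U'v , ¬Fv , v∉S) = inj₁ (move U'v ¬Fv v∉S (∈-jumpˡ z∈S (U'⇒≢w (pair⊆U' z∈xy))))
    ...   | no none = inj₂ full
      where
      full : Full U F S
      full v Uv with F? v | v ∈? S | U⊆U'∪w Uv
      ... | yes Fv | _ | _ = inj₁ Fv
      ... | no _ | yes v∈S | _ = inj₂ v∈S
      ... | no _ | no v∉S | inj₂ refl = contradiction w∈S v∉S
      ... | no ¬Fv | no v∉S | inj₁ U'v = contradiction (v , U'v , ¬Fv , v∉S) none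

  raise-gathers : Covers Q Q' → (∀ {p} → P p → U' p) → (∀ {z} → F z → z ≢ w → F' z) →
    Separates U G P Q F ⊢ S ↝ T → Gathers U' G' P Q' F' T → Gathers U G P Q F S
  raise-gathers {Q = Q} {Q' = Q'} {P = P} {F = F} {F' = F'} covQ P⊆U' F⊆ S↝T (gathers C sepC T↝C P⊆C) =
    gathers C (up' sepC) (S↝T ◅◅ map-↝ up' T↝C) P⊆C
    where
    up' : ∀ {S} → Separates U' G' P Q' F' S → Separates U G P Q F S
    up' = raise (old-covers P⊆U') covQ (λ (Pw , _) → w∉U' (P⊆U' Pw)) F⊆

  gather-old : (∀ z → Dec (U' z)) → (∀ z → Dec (F z)) → ∀ z → Pair x y z → ¬ F z →
    (∀ {p} → P p → U' p) → (∀ {p} → P p → ¬ F p) → Transfers z Q Q' →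
    (∀ {T} → Separates U' G' P Q' F T → Gathers U' G' P Q' F T) →
    Separates U G P Q F S → Gathers U G P Q F S
  gather-old U'? F? z z∈xy ¬Fz P⊆U' ¬FP tQ rec sep
    with reduce U'? F? z z∈xy ¬Fz (old-transfers P⊆U') tQ (λ (Pw , _) → w∉U' (P⊆U' Pw)) sep
  ... | inj₁ (T , sepT , S↝T) = raise-gathers (covers tQ) P⊆U' (λ Fv _ → Fv) S↝T (rec sepT)
  -- A full `S` occupies every vertex outside `F`, in particular all of `P`.
  ... | inj₂ full = gathers _ sep ε λ Pp →
        [ (λ Fp → contradiction Fp (¬FP Pp)) , (λ p∈S → p∈S) ]′ (full _ (U'⊆U (P⊆U' Pp)))

  -- Gather on xy in G', then move the token on y to w.
  gather-new : (∀ z → Dec (U' z)) → (∀ z → Dec (F z)) → ¬ F w → ¬ F x → ¬ F y →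
    (∀ {p} → P p → Pair w x p) → (∀ {p} → Pair w x p → P p) → (∀ {q} → Q q → U' q) →
    (∀ {T} → Separates U' G' (Pair x y) Q F T → Gathers U' G' (Pair x y) Q F T) →
    Separates U G P Q F S → Gathers U G P Q F S
  gather-new {F = F} {P = P} {Q = Q} {S = S} U'? F? ¬Fw ¬Fx ¬Fy P⊆ ⊆P Q⊆U' rec sep
    with reduce U'? F? y (inj₂ refl) ¬Fy (new-transfers P⊆ ⊆P) (old-transfers Q⊆U')
           (λ (_ , Qw) → w∉U' (Q⊆U' Qw)) sep
  ... | inj₂ full = gathers S sep ε occ
    where
    occ : ∀ {p} → P p → p ∈ S
    occ Pp with P⊆ Pp
    ... | inj₁ refl = [ (λ Fw → contradiction Fw ¬Fw) , (λ w∈S → w∈S) ]′ (full w w∈U)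
    ... | inj₂ refl = [ (λ Fx → contradiction Fx ¬Fx) , (λ x∈S → x∈S) ]′ (full x (U'⊆U (ends xy)))
  ... | inj₁ (T , sepT , S↝T) with rec sepT
  ...   | gathers C sepC T↝C xy⊆C = prepend (jump-gathers (up' sepC) (xy⊆C (inj₂ refl)) w∉C w∈U ¬Fw occ)
    where
    up' : ∀ {S} → Separates U' G' (Pair x y) Q F S → Separates U G P Q F S
    up' = raise (covers (new-transfers P⊆ ⊆P)) (old-covers Q⊆U') (λ (_ , Qw) → w∉U' (Q⊆U' Qw)) (λ Fv _ → Fv)
    w∉C : w ∉ C
    w∉C w∈C = w∉U' (within sepC w∈C)
    occ : ∀ {p} → P p → p ∈ jump C y w
    occ Pp with P⊆ Pp
    ... | inj₁ refl = ∈-jumpʳ C y w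
    ... | inj₂ refl = ∈-jumpˡ (xy⊆C (inj₁ refl)) x≢y
    prepend : Gathers U G P Q F C → Gathers U G P Q F S
    prepend (gathers D sepD C↝D P⊆D) = gathers D sepD (S↝T ◅◅ map-↝ up' T↝C ◅◅ C↝D) P⊆D

-- Gathering tokens on a terminal edge

data EdgeView {N} (U' : VertexSet N) (G' : Graph N) (U : VertexSet N) (G : Graph N) (w : Fin N) (P : VertexSet N) : Set where
  old : IsEdge G' P → EdgeView U' G' U G w P
  new : ∀ {c d} → Extends U' G' U G c d w →
    (∀ {p} → P p → Pair w c p) → (∀ {p} → Pair w c p → P p) → EdgeView U' G' U G w P

-- For an edge at `w` the extension is oriented so that its first end is the other end of that edge,
-- which leaves a single case to treat.
edgeView : ∀ {x y w : Fin N} → Extends U' G' U G x y w → IsEdge G P → EdgeView U' G' U G w P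
edgeView E (isEdge adj P⊆ ⊆P) with Extends.down E adj
... | inj₁ adj' = old (isEdge adj' P⊆ ⊆P)
... | inj₂ (inj₁ (refl , inj₁ refl)) = new E P⊆ ⊆P
... | inj₂ (inj₁ (refl , inj₂ refl)) = new (flip E) P⊆ ⊆P
... | inj₂ (inj₂ (refl , inj₁ refl)) = new E (λ Pp → Sum.swap (P⊆ Pp)) (λ p → ⊆P (Sum.swap p))
... | inj₂ (inj₂ (refl , inj₂ refl)) = new (flip E) (λ Pp → Sum.swap (P⊆ Pp)) (λ p → ⊆P (Sum.swap p))

pair-isEdge : ∀ {u v} → Adj G u v → IsEdge G (Pair u v)
pair-isEdge e = isEdge e (λ p → p) (λ p → p)

edge⊆ : ∀ {U : VertexSet N} → (∀ {a b} → Adj G a b → U a) → IsEdge G P → ∀ {p} → P p → U p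
edge⊆ {G = G} ends (isEdge adj P⊆ _) Pp with P⊆ Pp
... | inj₁ refl = ends adj
... | inj₂ refl = ends (sym G adj)

∅? : ∀ (z : Fin N) → Dec (∅ z)
∅? _ = no λ ()

-- A terminal edge away from `w` survives in `G'`, and one at `w` is exchanged for `xy`. If both are
-- at `w`, their common vertex `w` must be occupied, and 2-connectedness supplies a second token.
edge-edge : Built U G → Biconnected U G → IsEdge G P → IsEdge G Q →
  Separates U G P Q ∅ S → Gathers U G P Q ∅ S
edge-edge {P = P} {Q = Q} {S = S} (base a b _ _ _ e⊆) bi (isEdge uv P⊆ _) (isEdge uv' _ ⊆Q) sep =
  gathers S sep ε occ
  where
  joins⊆ : ∀ {u v u' v' z : Fin _} → Joins a b u v → Joins a b u' v' → Pair u v z → Pair u' v' z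
  joins⊆ (inj₁ (refl , refl)) (inj₁ (refl , refl)) p = p
  joins⊆ (inj₁ (refl , refl)) (inj₂ (refl , refl)) p = Sum.swap p
  joins⊆ (inj₂ (refl , refl)) (inj₁ (refl , refl)) p = Sum.swap p
  joins⊆ (inj₂ (refl , refl)) (inj₂ (refl , refl)) p = p
  -- In the base graph both terminals are the same edge, so an unoccupied vertex of it would be a
  -- walk from `P` to `Q`.
  occ : ∀ {p} → P p → p ∈ S
  occ {p} Pp with p ∈? S
  ... | yes p∈S = p∈S
  ... | no p∉S = contradiction (here p∉S) (cuts sep Pp (⊆Q (joins⊆ (e⊆ uv) (e⊆ uv') (P⊆ Pp))))
edge-edge {Q = Q} {S = S} (ext {w = w} B E) bi eP eQ sep with edgeView E eP | edgeView E eQ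
... | old eP' | old eQ' =
      gather-old (Built-dec B) ∅? _ (inj₁ refl) (λ ()) (edge⊆ ends eP') (λ _ ()) (old-transfers (edge⊆ ends eQ'))
        (edge-edge B (biconnected bi) eP' eQ') sep
  where open Extension E
... | old eP' | new E' Q⊆ ⊆Q =
      gather-old (Built-dec B) ∅? _ (inj₂ refl) (λ ()) (edge⊆ ends eP') (λ _ ()) (new-transfers Q⊆ ⊆Q)
        (edge-edge B (biconnected bi) eP' (pair-isEdge xy)) sep
  where open Extension E'
... | new E' P⊆ ⊆P | old eQ' =
      gather-new (Built-dec B) ∅? (λ ()) (λ ()) (λ ()) P⊆ ⊆P (edge⊆ ends eQ')
        (edge-edge B (biconnected bi) (pair-isEdge xy) eQ') sep
  where open Extension E'
... | new {c} E' P⊆ ⊆P | new {c₂} E'' Q⊆ ⊆Q =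
      -- The other ends of the two terminal edges are joined by a walk avoiding `w`, so `w` alone
      -- does not separate.
      fill-gathers sep P⊆ (⊆P (inj₂ refl)) (U'⊆U (ends xy)) (λ ()) w∈S (⊆Q (inj₂ refl))
        (bi w (U'⊆U (ends xy)) (U'⊆U (ends X₂.xy)) (U'⇒≢w (ends xy)) (U'⇒≢w (ends X₂.xy)))
  where
  open Extension E'
  module X₂ = Extension E''
  w∈S : w ∈ S
  w∈S with w ∈? S
  ... | yes w∈S = w∈S
  ... | no w∉S = contradiction (here w∉S) (cuts sep (⊆P (inj₁ refl)) (⊆Q (inj₁ refl)))

-- The unoccupied `t` cannot lie on the terminal edge, which rules out the base graph. In an
-- extension the cases that do not recurse are `t` equal to `w` and a terminal edge at `w` with `t`
-- the other neighbour of `w`.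
edge-vertex : Built U G → Biconnected U G → IsEdge G P → ∀ t → U t →
  Separates U G P (_≡ t) (_≡ t) S → Gathers U G P (_≡ t) (_≡ t) S
edge-vertex {U = U} {G = G} {P = P} {S = S} B bi eP t Ut sep = go B
  where
  t∉S : t ∉ S
  t∉S t∈S = avoids sep t∈S refl

  t∉P : ∀ {p} → P p → p ≢ t
  t∉P Pp refl = cuts sep Pp refl (here t∉S)

  go : Built U G → Gathers U G P (_≡ t) (_≡ t) S
  go (base a b _ _ U⊆ e⊆) = contradiction refl (t∉P (IsEdge.⊆P eP (joins (e⊆ (IsEdge.adj eP)) (U⊆ Ut))))
    where
    joins : ∀ {u v : Fin _} → Joins a b u v → Pair a b t → Pair u v t
    joins (inj₁ (refl , refl)) p = p
    joins (inj₂ (refl , refl)) p = Sum.swap p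
  go (ext {x = x} {w = w} B E) with t ≟ w | edgeView E eP
  ... | yes refl | new _ _ ⊆P = contradiction refl (t∉P (⊆P (inj₁ refl)))
  ... | yes refl | old eP' =
        -- The terminal `t` becomes the edge `xy`, whose ends are open to tokens, so the forbidden
        -- set becomes empty.
        raise-gathers (λ { refl → inj₁ (refl , inj₁ refl , inj₂ refl) }) (edge⊆ ends eP')
          (λ t≡w t≢w → t≢w t≡w) ε
          (edge-edge B (biconnected bi) eP' (pair-isEdge xy)
            (restrict inj₁ (λ p → inj₂ (refl , p)) (λ ()) t∉S sep))
    where open Extension E
  -- The end of `xy` chosen to be occupied must not be the closed vertex `t`.
  ... | no t≢w | old eP' with x ≟ t
  ...   | no x≢t =
          gather-old (Built-dec B) (_≟ t) _ (inj₁ refl) x≢t (edge⊆ ends eP') t∉P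
            (old-transfers λ { refl → U≢w⇒U' Ut t≢w })
            (edge-vertex B (biconnected bi) eP' t (U≢w⇒U' Ut t≢w)) sep
    where open Extension E
  ...   | yes refl =
          gather-old (Built-dec B) (_≟ t) _ (inj₂ refl) (λ y≡x → x≢y (≡.sym y≡x)) (edge⊆ ends eP') t∉P
            (old-transfers λ { refl → U≢w⇒U' Ut t≢w })
            (edge-vertex B (biconnected bi) eP' t (U≢w⇒U' Ut t≢w)) sep
    where open Extension E
  go (ext {w = w} B E) | no t≢w | new {c} {d} E' P⊆ ⊆P with d ≟ t
  ... | no d≢t =
        gather-new (Built-dec B) (_≟ t) (λ w≡t → t≢w (≡.sym w≡t)) (t∉P (⊆P (inj₂ refl))) d≢t P⊆ ⊆P
          (λ { refl → U≢w⇒U' Ut t≢w })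
          (edge-vertex B (biconnected bi) (pair-isEdge xy) t (U≢w⇒U' Ut t≢w)) sep
    where open Extension E'
  -- Exchanging the terminal for `xy` would put `t` on it. Instead, `w` is adjacent to `t` and so
  -- must be occupied, and a walk from `c` to `t` avoiding `w` shows that there is a second token.
  ... | yes refl =
        fill-gathers sep P⊆ (⊆P (inj₂ refl)) (U'⊆U (ends xy)) x≢y w∈S refl
          (bi w (U'⊆U (ends xy)) Ut (U'⇒≢w (ends xy)) t≢w)
    where
    open Extension E'
    w∈S : w ∈ S
    w∈S with w ∈? S
    ... | yes w∈S = w∈S
    ... | no w∉S = contradiction (step w∉S (sym G yw) (here t∉S)) (cuts sep (⊆P (inj₁ refl)) refl)

-- Reconfiguration between two vertex terminals

delete : Graph N → Fin N → Fin N → Graph N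
delete G s t = record
  { Adj = λ a b → Adj G a b × ¬ Joins s t a b
  ; sym = λ (ab , ¬st) → sym G ab , λ j → ¬st (joins-sym j)
  ; irrefl = λ (aa , _) → irrefl G aa
  }
  where
  joins-sym : ∀ {a b} → Joins s t b a → Joins s t a b
  joins-sym (inj₁ (p , q)) = inj₂ (q , p)
  joins-sym (inj₂ (p , q)) = inj₁ (q , p)

-- The edge is deleted only here, so the induction itself runs on `G`, which keeps its
-- 2-connectedness.
Cut : VertexSet N → Graph N → Fin N → Fin N → Subset N → Set
Cut U G s t = Separates U (delete G s t) (_≡ s) (_≡ t) (Pair s t)

Cut-sym : Cut U G s t S → Cut U G t s S
Cut-sym {U = U} {G = G} {s = s} {t = t} {S = S} cut = separates (within cut) (λ z∈ p → avoids cut z∈ (Sum.swap p))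
  λ p q r → cuts cut q p (reverse (map-Reach (λ (e , ¬st) → e , (λ j → ¬st (Sum.swap j))) (λ v∈ → v∈) r))

Connects : VertexSet N → Graph N → Fin N → Fin N → Set
Connects {N} U G s t = ∀ {A B : Subset N} → Cut U G s t A → Cut U G s t B → ∣ A ∣ ≡ ∣ B ∣ →
  Cut U G s t ⊢ A ↝ B

≡⇒↝ : ∀ {P : Subset N → Set} → A ≡ B → P ⊢ A ↝ B
≡⇒↝ refl = ε

module _ {U' : VertexSet N} {G' U G} {x y w : Fin N} (E : Extends U' G' U G x y w) where
  open Extension E

  -- The deleted edge is neither `xy` nor at `w`, so deletion commutes with the extension.
  delete-inner : ∀ {s t} → U' s → U' t → ¬ Joins s t x y → Extends U' (delete G' s t) U (delete G s t) x y w
  delete-inner {s} {t} U's U't ¬xy = record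
    { w∉U' = w∉U' ; U'⊆U = U'⊆U ; w∈U = w∈U ; U⊆U'∪w = U⊆U'∪w ; ends = λ (e , _) → ends e
    ; xy = xy , ¬xy
    ; xw = xw , ¬w ; yw = yw , ¬w
    ; down = λ (e , ¬st) → Sum.map₁ (_, ¬st) (down e)
    ; up = λ (e , ¬st) → Sum.map₁ (_, ¬st) (up e)
    }
    where
    ¬w : ∀ {a} → ¬ Joins s t a w
    ¬w (inj₁ (_ , refl)) = w∉U' U't
    ¬w (inj₂ (_ , refl)) = w∉U' U's

  -- The only neighbours of `w` are `x` and `y`, so no edge `wt` exists and the smaller graph stays
  -- as it is.
  delete-outer : ∀ {t} → U' t → ¬ Pair x y t → Extends U' G' U (delete G w t) x y w
  delete-outer {t} U't ¬xy = record
    { w∉U' = w∉U' ; U'⊆U = U'⊆U ; w∈U = w∈U ; U⊆U'∪w = U⊆U'∪w ; ends = ends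
    ; xy = xy
    ; xw = xw , ¬w (inj₁ refl) ; yw = yw , ¬w (inj₂ refl)
    ; down = λ (e , _) → down e
    ; up = λ e → Sum.map₁ (_, ¬old (ends e) (ends' e)) (up e)
    }
    where
    ¬w : ∀ {a} → Pair x y a → ¬ Joins w t a w
    ¬w p (inj₁ (refl , _)) = w∉U' (pair⊆U' p)
    ¬w p (inj₂ (refl , _)) = ¬xy p
    ¬old : ∀ {a b} → U' a → U' b → ¬ Joins w t a b
    ¬old Ua Ub (inj₁ (refl , _)) = w∉U' Ua
    ¬old Ua Ub (inj₂ (_ , refl)) = w∉U' Ub

  -- Some end of `xy` is neither `s` nor `t`, which provides the end that `reduce` asks for. A full
  -- separator is the only one of its size; otherwise both separators move to `G'` and are joined
  -- there.
  connects-inner : (∀ z → Dec (U' z)) → ∀ s t → s ≢ t → U' s → U' t → ¬ Joins s t x y →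
    Connects U' G' s t → Connects U G s t
  connects-inner U'? s t s≢t U's U't ¬xy rec {A} {B} cutA cutB eq = join (red cutA) (red cutB)
    where
    module X = Extension (delete-inner U's U't ¬xy)

    F? : ∀ z → Dec (Pair s t z)
    F? z = (z ≟ s) ⊎-dec (z ≟ t)

    Ps : ∀ {p} → p ≡ s → U' p
    Ps refl = U's

    Qt : ∀ {p} → p ≡ t → U' p
    Qt refl = U't

    ¬PQ : ¬ (w ≡ s × w ≡ t)
    ¬PQ (refl , p) = s≢t p

    free : ∃ λ z → Pair x y z × ¬ Pair s t z
    free with F? x | F? y
    ... | no ¬Fx | _ = x , inj₁ refl , ¬Fx
    ... | yes _ | no ¬Fy = y , inj₂ refl , ¬Fy
    ... | yes (inj₁ refl) | yes (inj₁ refl) = contradiction refl x≢y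
    ... | yes (inj₁ refl) | yes (inj₂ refl) = contradiction (inj₁ (refl , refl)) ¬xy
    ... | yes (inj₂ refl) | yes (inj₁ refl) = contradiction (inj₂ (refl , refl)) ¬xy
    ... | yes (inj₂ refl) | yes (inj₂ refl) = contradiction refl x≢y

    red : ∀ {S} → Cut U G s t S → X.Reduct (_≡ s) (_≡ t) (_≡ s) (_≡ t) (Pair s t) S ⊎ Full U (Pair s t) S
    red = X.reduce U'? F? (proj₁ free) (proj₁ (proj₂ free)) (proj₂ (proj₂ free))
      (X.old-transfers Ps) (X.old-transfers Qt) ¬PQ

    up' : ∀ {S} → Cut U' G' s t S → Cut U G s t S
    up' = X.raise (X.old-covers Ps) (X.old-covers Qt) ¬PQ (λ Fz _ → Fz)

    join : _ → _ → Cut U G s t ⊢ A ↝ B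
    join (inj₂ full) _ = ≡⇒↝ (≡.sym (full-unique full cutB (≡.sym eq)))
    join (inj₁ _) (inj₂ full) = ≡⇒↝ (full-unique full cutA eq)
    join (inj₁ (C , cutC , A↝C)) (inj₁ (D , cutD , B↝D)) =
      A↝C ◅◅ map-↝ up' (rec cutC cutD (trans (≡.sym (↝-∣∣ A↝C)) (trans eq (↝-∣∣ B↝D)))) ◅◅ sym-↝ B↝D

  -- Here w is a path of length two between x and y in parallel with the rest of the graph.
  connects-parallel : Connects U' G' x y → Connects U G x y
  connects-parallel rec {A} {B} cutA cutB eq =
    ≡⇒↝ (≡.sym (remove-insert A (w∈ cutA))) ◅◅
    Star.gmap (_∪ ⁅ w ⁆) insert-step (rec (lower cutA) (lower cutB) eq') ◅◅
    ≡⇒↝ (remove-insert B (w∈ cutB))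
    where
    x≢w : x ≢ w
    x≢w = U'⇒≢w (ends xy)
    y≢w : y ≢ w
    y≢w = U'⇒≢w (ends' xy)

    ¬joins-w : ∀ {a} → ¬ Joins x y a w
    ¬joins-w (inj₁ (_ , refl)) = y≢w refl
    ¬joins-w (inj₂ (_ , refl)) = x≢w refl

    -- The path from `x` through `w` to `y` survives the deletion, so every cut has a token on `w`.
    w∈ : ∀ {S} → Cut U G x y S → w ∈ S
    w∈ {S} cut with w ∈? S
    ... | yes w∈S = w∈S
    ... | no w∉S = contradiction
          (step (λ x∈ → avoids cut x∈ (inj₁ refl)) (xw , ¬joins-w)
            (step w∉S (sym (delete G x y) (yw , ¬joins-w)) (here (λ y∈ → avoids cut y∈ (inj₂ refl)))))
          (cuts cut refl refl)

    eq' : ∣ A - w ∣ ≡ ∣ B - w ∣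
    eq' = ℕ.suc-injective (trans (≡.sym (∣p∣≡1+∣p-x∣ A (w∈ cutA))) (trans eq (∣p∣≡1+∣p-x∣ B (w∈ cutB))))

    lower : ∀ {S} → Cut U G x y S → Cut U' G' x y (S - w)
    lower {S} cut = separates
      (λ z∈ → let z∈S , z≢w = ∈-remove⁻ S z∈ in U≢w⇒U' (within cut z∈S) z≢w)
      (λ z∈ → avoids cut (proj₁ (∈-remove⁻ S z∈)))
      (λ { refl refl r → cuts cut refl refl (walk x≢w r) })
      where
      walk : ∀ {a b} → a ≢ w → Reach (delete G' x y) (S - w) a b → Reach (delete G x y) S a b
      walk a≢w (here a∉) = here (λ a∈S → a∉ (x∈p∧x≢y⇒x∈p-y a∈S a≢w))
      walk a≢w (step a∉ (ab , ¬xy) r) with up ab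
      ... | inj₁ ab' = step (λ a∈S → a∉ (x∈p∧x≢y⇒x∈p-y a∈S a≢w)) (ab' , ¬xy) (walk (U'⇒≢w (ends' ab)) r)
      -- The one edge that `G` may lack is the one deleted from `G'`.
      ... | inj₂ j = contradiction j ¬xy

    insert : ∀ {S} → Cut U' G' x y S → Cut U G x y (S ∪ ⁅ w ⁆)
    insert {S} cut = separates
      (λ z∈ → [ (λ z∈S → U'⊆U (within cut z∈S)) , (λ { refl → w∈U }) ]′ (∈-insert⁻ S z∈))
      (λ z∈ → [ avoids cut , (λ { refl → [ (λ w≡x → x≢w (≡.sym w≡x)) , (λ w≡y → y≢w (≡.sym w≡y)) ]′ }) ]′ (∈-insert⁻ S z∈))
      (λ { refl refl r → cuts cut refl refl (walk r) })
      where
      w∈+ : w ∈ S ∪ ⁅ w ⁆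
      w∈+ = ∈-insertʳ S
      walk : ∀ {a b} → Reach (delete G x y) (S ∪ ⁅ w ⁆) a b → Reach (delete G' x y) S a b
      walk (here a∉) = here (λ a∈S → a∉ (∈-insertˡ a∈S))
      walk (step a∉ (ab , ¬xy) r) with down ab
      ... | inj₁ ab' = step (λ a∈S → a∉ (∈-insertˡ a∈S)) (ab' , ¬xy) (walk r)
      ... | inj₂ (inj₁ (refl , _)) = contradiction w∈+ a∉
      ... | inj₂ (inj₂ (refl , _)) = contradiction w∈+ (head-∉ r)

    insert-step : ∀ {S T} → Step (Cut U' G' x y) S T → Step (Cut U G x y) (S ∪ ⁅ w ⁆) (T ∪ ⁅ w ⁆)
    insert-step (cutS , cutT , adj) =
      insert cutS , insert cutT ,
      insert-adjacent (λ w∈S → w∉U' (within cutS w∈S)) (λ w∈T → w∉U' (within cutT w∈T)) adj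

  -- Without the edge wy the only neighbour of w is x, so every set containing x is a cut.
  connects-pendant : Connects U G w y
  connects-pendant {A} {B} cutA cutB eq = join (fill cutA) (fill cutB)
    where
    y≢w : y ≢ w
    y≢w = U'⇒≢w (ends' xy)

    ¬Fx : ¬ Pair w y x
    ¬Fx (inj₁ x≡w) = U'⇒≢w (ends xy) x≡w
    ¬Fx (inj₂ x≡y) = x≢y x≡y

    Ux : U x
    Ux = U'⊆U (ends xy)

    cut∋x : ∀ {S} → (∀ {z} → z ∈ S → U z) → (∀ {z} → z ∈ S → ¬ Pair w y z) → x ∈ S → Cut U G w y S
    cut∋x {S} within avoids x∈S = separates within avoids λ { refl refl r → blocked r }
      where
      blocked : ¬ Reach (delete G w y) S w y
      blocked (here _) = y≢w refl
      blocked (step w∉S (wc , ¬wy) r) with down wc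
      ... | inj₁ wc' = w∉U' (ends wc')
      ... | inj₂ (inj₁ (_ , inj₁ refl)) = head-∉ r x∈S
      ... | inj₂ (inj₁ (_ , inj₂ refl)) = ¬wy (inj₁ (refl , refl))
      ... | inj₂ (inj₂ (_ , w∈xy)) = w∉U' (pair⊆U' w∈xy)

    fill : ∀ {S} → Cut U G w y S →
      (∃ λ C → Cut U G w y C × (Cut U G w y ⊢ S ↝ C) × x ∈ C) ⊎ (∀ {z} → z ∉ S)
    fill {S} cut with x ∈? S
    ... | yes x∈S = inj₁ (S , cut , ε , x∈S)
    ... | no x∉S with any? (_∈? S)
    ...   | no empty = inj₂ λ z∈S → empty (_ , z∈S)
    ...   | yes (a , a∈S) = inj₁ (jump S a x , cut' , jump-↝ a∈S x∉S cut cut' , ∈-jumpʳ S a x)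
      where
      cut' : Cut U G w y (jump S a x)
      cut' = cut∋x (jump-within cut Ux) (jump-avoids cut ¬Fx) (∈-jumpʳ S a x)

    join : _ → _ → Cut U G w y ⊢ A ↝ B
    -- If one of the sets has no token to move to `x`, both are empty by equal sizes.
    join (inj₂ empty) _ = ≡⇒↝ (⊆∧∣∣≡⇒≡ (λ z∈A → contradiction z∈A empty) eq)
    join (inj₁ _) (inj₂ empty) = ≡⇒↝ (≡.sym (⊆∧∣∣≡⇒≡ (λ z∈B → contradiction z∈B empty) (≡.sym eq)))
    join (inj₁ (C , cutC , A↝C , x∈C)) (inj₁ (D , cutD , B↝D , x∈D)) =
      A↝C ◅◅
      interval-↝ C D (trans (≡.sym (↝-∣∣ A↝C)) (trans eq (↝-∣∣ B↝D)))
        (λ low high → cut∋x (λ z∈ → [ within cutC , within cutD ]′ (high z∈))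
                            (λ z∈ → [ avoids cutC , avoids cutD ]′ (high z∈)) (low x∈C x∈D)) ◅◅
      sym-↝ B↝D

  -- The terminal `w` is replaced by the edge `xy`, on which `edge-vertex` gathers both separators.
  -- Between the two targets every intermediate set keeps `x` and `y` occupied. The whole path lies
  -- in `G'` and is raised to `G` at the end.
  connects-outer : Built U' G' → Biconnected U' G' → ∀ t → U' t → ¬ Pair x y t → Connects U G w t
  connects-outer built bi t U't ¬xy {A} {B} cutA cutB eq = join (gather cutA) (gather cutB)
    where
    module X = Extension (delete-outer U't ¬xy)

    up' : ∀ {S} → Separates U' G' (Pair x y) (_≡ t) (_≡ t) S → Cut U G w t S
    up' = X.raise (λ { refl → inj₁ (refl , inj₁ refl , inj₂ refl) }) (X.old-covers λ { refl → U't })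
      (λ { (_ , refl) → w∉U' U't }) λ { (inj₁ z≡w) z≢w → contradiction z≡w z≢w ; (inj₂ z≡t) _ → z≡t }

    gather : ∀ {S} → Cut U G w t S → Gathers U' G' (Pair x y) (_≡ t) (_≡ t) S
    gather cut = edge-vertex built bi (pair-isEdge xy) t U't
      (X.restrict (λ p → inj₂ (refl , p)) inj₁ inj₂ (λ w∈S → avoids cut w∈S (inj₁ refl)) cut)

    join : Gathers U' G' (Pair x y) (_≡ t) (_≡ t) A → Gathers U' G' (Pair x y) (_≡ t) (_≡ t) B →
      Cut U G w t ⊢ A ↝ B
    join (gathers C sepC A↝C xy⊆C) (gathers D sepD B↝D xy⊆D) = map-↝ up' (
      A↝C ◅◅
      interval-↝ C D (trans (≡.sym (↝-∣∣ A↝C)) (trans eq (↝-∣∣ B↝D)))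
        (λ low high → occupied-separates (λ z∈ → [ within sepC , within sepD ]′ (high z∈))
          (λ z∈ → [ avoids sepC , avoids sepD ]′ (high z∈)) (λ p → low (xy⊆C p) (xy⊆D p))) ◅◅
      sym-↝ B↝D)

connects-from-new : ∀ {x y w : Fin N} → Built U' G' → Extends U' G' U G x y w → Biconnected U' G' →
  ∀ t → U' t → Connects U G w t
connects-from-new {x = x} {y = y} built E bi t U't with x ≟ t | y ≟ t
... | yes refl | _ = connects-pendant (flip E)
... | no _ | yes refl = connects-pendant E
... | no x≢t | no y≢t =
      connects-outer E built bi t U't [ (λ t≡x → x≢t (≡.sym t≡x)) , (λ t≡y → y≢t (≡.sym t≡y)) ]′

-- If the last vertex `w` is a terminal, the result follows without recursion. Otherwise either `xy`
-- is the pair `st`, and `w` holds a fixed token, or the separators reduce to `G'`.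
vertex-vertex : Built U G → Biconnected U G → ∀ s t → s ≢ t → U s → U t → Connects U G s t
vertex-vertex (base {U = U} a b _ _ U⊆ _) bi s t s≢t Us Ut cutA cutB eq =
  -- The base graph has no vertex besides `s` and `t`, so every cut is empty.
  ≡⇒↝ (full-unique (λ z Uz → inj₁ (forbidden (U⊆ Us) (U⊆ Ut) (U⊆ Uz))) cutA eq)
  where
  forbidden : ∀ {z} → Pair a b s → Pair a b t → Pair a b z → Pair s t z
  forbidden (inj₁ refl) (inj₁ refl) _ = contradiction refl s≢t
  forbidden (inj₁ refl) (inj₂ refl) p = p
  forbidden (inj₂ refl) (inj₁ refl) p = Sum.swap p
  forbidden (inj₂ refl) (inj₂ refl) _ = contradiction refl s≢t
vertex-vertex {G = G} (ext {x = x} {y = y} {w = w} built E) bi s t s≢t Us Ut {A} {B} cutA cutB eq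
  with s ≟ w | t ≟ w
... | yes refl | yes refl = contradiction refl s≢t
... | yes refl | no t≢w =
      connects-from-new built E (biconnected bi) t (U≢w⇒U' Ut t≢w) cutA cutB eq
  where open Extension E
... | no s≢w | yes refl = map-↝ Cut-sym
      (connects-from-new built E (biconnected bi) s (U≢w⇒U' Us s≢w) (Cut-sym cutA) (Cut-sym cutB) eq)
  where open Extension E
... | no s≢w | no t≢w with ((x ≟ s) ×-dec (y ≟ t)) ⊎-dec ((x ≟ t) ×-dec (y ≟ s))
...   | yes (inj₁ (refl , refl)) = connects-parallel E (vertex-vertex built (biconnected bi) s t s≢t U's U't) cutA cutB eq
  where
  open Extension E
  U's = U≢w⇒U' Us s≢w
  U't = U≢w⇒U' Ut t≢w
...   | yes (inj₂ (refl , refl)) = connects-parallel (flip E) (vertex-vertex built (biconnected bi) s t s≢t U's U't) cutA cutB eq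
  where
  open Extension E
  U's = U≢w⇒U' Us s≢w
  U't = U≢w⇒U' Ut t≢w
...   | no ¬xy = connects-inner E (Built-dec built) s t s≢t U's U't ¬xy
          (vertex-vertex built (biconnected bi) s t s≢t U's U't) cutA cutB eq
  where
  open Extension E
  U's = U≢w⇒U' Us s≢w
  U't = U≢w⇒U' Ut t≢w

-- From edge lists to extensions

private
  variable
    m : ℕ
    es : List (Edge m)

Linked : List (Edge m) → Fin m → Fin m → Set
Linked es i j = (i , j) ∈ₗ es ⊎ (j , i) ∈ₗ es

∈-mid⁻ : ∀ {X : Set} {e d : X} xs {ys} → e ∈ₗ xs ++ d ∷ ys → e ≡ d ⊎ e ∈ₗ xs ++ ys
∈-mid⁻ xs e∈ with ∈-++⁻ xs e∈
... | inj₁ e∈xs = inj₂ (∈-++⁺ˡ e∈xs)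
... | inj₂ (here e≡d) = inj₁ e≡d
... | inj₂ (there e∈ys) = inj₂ (∈-++⁺ʳ xs e∈ys)

∈-mid⁺ : ∀ {X : Set} {e d : X} xs {ys} → e ∈ₗ xs ++ ys → e ∈ₗ xs ++ d ∷ ys
∈-mid⁺ xs e∈ with ∈-++⁻ xs e∈
... | inj₁ e∈xs = ∈-++⁺ˡ e∈xs
... | inj₂ e∈ys = ∈-++⁺ʳ xs (there e∈ys)

∈-mid : ∀ {X : Set} {d : X} xs {ys} → d ∈ₗ xs ++ d ∷ ys
∈-mid xs = ∈-++⁺ʳ xs (here refl)

∈-double⁻ : ∀ {X : Set} {e d : X} xs {ys} → e ∈ₗ xs ++ d ∷ d ∷ ys → e ∈ₗ xs ++ d ∷ ys
∈-double⁻ xs e∈ with ∈-mid⁻ xs e∈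
... | inj₁ refl = ∈-mid xs
... | inj₂ e∈' = e∈'

∈-series⁻ : ∀ {n} (xs ys : List (Edge n)) {u v : Fin n} {e} →
  e ∈ₗ map liftE xs ++ (inject₁ u , fromℕ n) ∷ (fromℕ n , inject₁ v) ∷ map liftE ys →
  (∃ λ d → d ∈ₗ xs ++ (u , v) ∷ ys × e ≡ liftE d) ⊎ e ≡ (inject₁ u , fromℕ n) ⊎ e ≡ (fromℕ n , inject₁ v)
∈-series⁻ xs ys e∈ with ∈-++⁻ (map liftE xs) e∈
... | inj₁ e∈xs = let d , d∈ , eq = ∈-map⁻ liftE e∈xs in inj₁ (d , ∈-++⁺ˡ d∈ , eq)
... | inj₂ (here eq) = inj₂ (inj₁ eq)
... | inj₂ (there (here eq)) = inj₂ (inj₂ eq)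
... | inj₂ (there (there e∈ys)) = let d , d∈ , eq = ∈-map⁻ liftE e∈ys in inj₁ (d , ∈-++⁺ʳ xs (there d∈) , eq)

∈-series⁺ : ∀ {n} (xs ys : List (Edge n)) {u v : Fin n} {d} → d ∈ₗ xs ++ (u , v) ∷ ys →
  d ≡ (u , v) ⊎ liftE d ∈ₗ map liftE xs ++ (inject₁ u , fromℕ n) ∷ (fromℕ n , inject₁ v) ∷ map liftE ys
∈-series⁺ xs ys d∈ with ∈-++⁻ xs d∈
... | inj₁ d∈xs = inj₂ (∈-++⁺ˡ (∈-map⁺ liftE d∈xs))
... | inj₂ (here eq) = inj₁ eq
... | inj₂ (there d∈ys) = inj₂ (∈-++⁺ʳ (map liftE xs) (there (there (∈-map⁺ liftE d∈ys))))

-- `realise` needs this for every intermediate edge list. A subdivision adds only edges between the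
-- new vertex and old ones.
loopless : SPMulti m es → ∀ {i} → ¬ (i , i) ∈ₗ es
loopless single (here ())
loopless single (there ())
loopless (series xs ys u v sp) e∈ with ∈-series⁻ xs ys e∈
... | inj₁ ((i , j) , d∈ , eq)
      with refl ← inject₁-injective (trans (≡.sym (cong proj₁ eq)) (cong proj₂ eq)) = loopless sp d∈
... | inj₂ (inj₁ eq) = fromℕ≢inject₁ (trans (≡.sym (cong proj₂ eq)) (cong proj₁ eq))
... | inj₂ (inj₂ eq) = fromℕ≢inject₁ (trans (≡.sym (cong proj₁ eq)) (cong proj₂ eq))
loopless (parallel xs ys e sp) e∈ = loopless sp (∈-double⁻ xs e∈)

-- The map `ι` places every intermediate multigraph in the one vertex type `Fin N`, so that token
-- sets never have to be re-indexed.
record Realises (es : List (Edge m)) (ι : Fin m → Fin N) (U : VertexSet N) (G : Graph N) : Set where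
  field
    U-ι : ∀ i → U (ι i)
    ι-U : ∀ {z} → U z → ∃ λ i → z ≡ ι i
    Adj-ι : ∀ {i j} → Linked es i j → Adj G (ι i) (ι j)
    ι-Adj : ∀ {a b} → Adj G a b → ∃₂ λ i j → a ≡ ι i × b ≡ ι j × Linked es i j

realise : (es : List (Edge m)) → (∀ {i} → ¬ (i , i) ∈ₗ es) →
  (ι : Fin m → Fin N) → (∀ {i j} → ι i ≡ ι j → i ≡ j) →
  Σ (Graph N) (Realises es ι (λ z → ∃ λ i → z ≡ ι i))
realise es noLoop ι inj = H , record
  { U-ι = λ i → i , refl ; ι-U = λ Uz → Uz
  ; Adj-ι = λ l → _ , _ , refl , refl , l ; ι-Adj = λ e → e }
  where
  H : Graph _
  H = record
    { Adj = λ a b → ∃₂ λ i j → a ≡ ι i × b ≡ ι j × Linked es i j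
    ; sym = λ (i , j , p , q , l) → j , i , q , p , Sum.swap l
    ; irrefl = λ (i , j , p , q , l) → irr (inj (trans (≡.sym p) q)) l
    }
    where
    irr : ∀ {i j} → i ≡ j → ¬ Linked es i j
    irr refl (inj₁ e∈) = noLoop e∈
    irr refl (inj₂ e∈) = noLoop e∈

-- A parallel step leaves the realised graph unchanged. A series step is an extension by
-- `ι (fromℕ n)`; the subdivided edge stays present if the list holds another copy of it, so
-- `Extends` has to allow both outcomes.
realises-built : SPMulti m es → (ι : Fin m → Fin N) → (∀ {i j} → ι i ≡ ι j → i ≡ j) →
  Realises es ι U G → Built U G
realises-built {U = U} {G = G} single ι inj R = base (ι zero) (ι (suc zero)) (U-ι _) (U-ι _) cover joins
  where
  open Realises R
  cover : ∀ {z} → U z → Pair (ι zero) (ι (suc zero)) z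
  cover Uz with ι-U Uz
  ... | zero , eq = inj₁ eq
  ... | suc zero , eq = inj₂ eq
  joins : ∀ {a b} → Adj G a b → Joins (ι zero) (ι (suc zero)) a b
  joins e with ι-Adj e
  ... | _ , _ , p , q , inj₁ (here refl) = inj₁ (p , q)
  ... | _ , _ , p , q , inj₂ (here refl) = inj₂ (p , q)
realises-built (parallel xs ys e sp) ι inj R = realises-built sp ι inj record
  { U-ι = U-ι ; ι-U = ι-U
  ; Adj-ι = λ l → Adj-ι (Sum.map (∈-mid⁺ xs) (∈-mid⁺ xs) l)
  ; ι-Adj = λ ab → let i , j , p , q , l = ι-Adj ab in i , j , p , q , Sum.map (∈-double⁻ xs) (∈-double⁻ xs) l
  }
  where open Realises R
realises-built {N = N} {U = U} {G = G} (series {n} xs ys u v sp) ι inj R =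
  ext (realises-built sp ι' inj' R') record
    { w∉U' = λ (i , eq) → fromℕ≢inject₁ (inj eq)
    ; U'⊆U = λ { (i , refl) → U-ι (inject₁ i) }
    ; w∈U = U-ι (fromℕ n)
    ; U⊆U'∪w = cover
    ; ends = λ (i , _ , p , _) → i , p
    ; xy = Realises.Adj-ι R' (inj₁ (∈-mid xs))
    ; xw = Adj-ι (inj₁ (∈-++⁺ʳ (map liftE xs) (here refl)))
    ; yw = Adj-ι (inj₂ (∈-++⁺ʳ (map liftE xs) (there (here refl))))
    ; down = down
    ; up = up
    }
  where
  open Realises R
  ι' : Fin n → Fin N
  ι' i = ι (inject₁ i)
  inj' : ∀ {i j} → ι' i ≡ ι' j → i ≡ j
  inj' eq = inject₁-injective (inj eq)
  realisation = realise _ (loopless sp) ι' inj'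
  H = proj₁ realisation
  R' = proj₂ realisation
  ω = ι (fromℕ n)

  cover : ∀ {z} → U z → (∃ λ i → z ≡ ι' i) ⊎ z ≡ ω
  cover Uz with ι-U Uz
  ... | i , eq with view i
  ...   | ‵fromℕ = inj₂ eq
  ...   | ‵inject₁ j = inj₁ (j , eq)

  down : ∀ {a b} → Adj G a b → Adj H a b ⊎ (a ≡ ω × Pair (ι' u) (ι' v) b) ⊎ (b ≡ ω × Pair (ι' u) (ι' v) a)
  down e with ι-Adj e
  ... | _ , _ , p , q , inj₁ e∈ with ∈-series⁻ xs ys e∈
  ...   | inj₁ (d , d∈ , refl) = inj₁ (_ , _ , p , q , inj₁ d∈)
  ...   | inj₂ (inj₁ refl) = inj₂ (inj₂ (q , inj₁ p))
  ...   | inj₂ (inj₂ refl) = inj₂ (inj₁ (p , inj₂ q))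
  down e | _ , _ , p , q , inj₂ e∈ with ∈-series⁻ xs ys e∈
  ...   | inj₁ (d , d∈ , refl) = inj₁ (_ , _ , p , q , inj₂ d∈)
  ...   | inj₂ (inj₁ refl) = inj₂ (inj₁ (p , inj₁ q))
  ...   | inj₂ (inj₂ refl) = inj₂ (inj₂ (q , inj₂ p))

  up : ∀ {a b} → Adj H a b → Adj G a b ⊎ Joins (ι' u) (ι' v) a b
  up (_ , _ , refl , refl , inj₁ e∈) with ∈-series⁺ xs ys e∈
  ... | inj₁ refl = inj₂ (inj₁ (refl , refl))
  ... | inj₂ e∈' = inj₁ (Adj-ι (inj₁ e∈'))
  up (_ , _ , refl , refl , inj₂ e∈) with ∈-series⁺ xs ys e∈
  ... | inj₁ refl = inj₂ (inj₂ (refl , refl))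
  ... | inj₂ e∈' = inj₁ (Adj-ι (inj₂ e∈'))

seriesParallel-built : ∀ {n} {G : Graph n} → SeriesParallel G → Built (λ _ → ⊤) G
seriesParallel-built {n} (m , es , sp , _ , f , iso) = realises-built sp ι ι-injective record
  { U-ι = λ _ → tt
  ; ι-U = λ {z} _ → to z , ≡.sym (ι-to z)
  ; Adj-ι = λ {i} {j} l → Equivalence.from (iso (ι i) (ι j))
      (≡.subst₂ (Linked es) (≡.sym (to-ι i)) (≡.sym (to-ι j)) l)
  ; ι-Adj = λ {a} {b} e → to a , to b , ≡.sym (ι-to a) , ≡.sym (ι-to b) , Equivalence.to (iso a b) e
  }
  where
  open Bijection f using (to; injective; strictlySurjective)
  -- The embedding is the inverse of the given isomorphism.
  ι : Fin m → Fin n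
  ι j = proj₁ (strictlySurjective j)
  to-ι : ∀ j → to (ι j) ≡ j
  to-ι j = proj₂ (strictlySurjective j)
  ι-to : ∀ z → ι (to z) ≡ z
  ι-to z = injective (to-ι (to z))
  ι-injective : ∀ {i j} → ι i ≡ ι j → i ≡ j
  ι-injective {i} {j} eq = trans (≡.sym (to-ι i)) (trans (cong to eq) (to-ι j))

theorem6 : ∀ {n} (G : Graph n) → TwoConnected G → SeriesParallel G →
    (s t : Fin n) → ¬ (s ≡ t) → ¬ Adj G s t →
    (A B : Subset n) → IsSeparator G s t A → IsSeparator G s t B →
    ∣ A ∣ ≡ ∣ B ∣ → Reconfigurable G s t A B
theorem6 {n} G (_ , _ , bi) sp s t s≢t ¬st A B sepA sepB eq =
  -- As `s` and `t` are non-adjacent, deleting the edge `st` changes nothing, and cuts are exactly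
  -- separators.
  map-↝ fromCut (vertex-vertex (seriesParallel-built sp) biconn s t s≢t tt tt (toCut sepA) (toCut sepB) eq)
  where
  biconn : Biconnected (λ _ → ⊤) G
  biconn c _ _ a≢c b≢c = bi c _ _ (x≢y⇒x∉⁅y⁆ a≢c) (x≢y⇒x∉⁅y⁆ b≢c)

  ¬joins : ∀ {a b} → Adj G a b → ¬ Joins s t a b
  ¬joins e (inj₁ (refl , refl)) = ¬st e
  ¬joins e (inj₂ (refl , refl)) = ¬st (sym G e)

  toCut : ∀ {S} → IsSeparator G s t S → Cut (λ _ → ⊤) G s t S
  toCut (s∉S , t∉S , ¬r) = separates (λ _ → tt)
    (λ { z∈S (inj₁ refl) → s∉S z∈S ; z∈S (inj₂ refl) → t∉S z∈S })
    (λ { refl refl r → ¬r (map-Reach proj₁ (λ v∈ → v∈) r) })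

  fromCut : ∀ {S} → Cut (λ _ → ⊤) G s t S → IsSeparator G s t S
  fromCut cut =
    (λ s∈S → avoids cut s∈S (inj₁ refl)) , (λ t∈S → avoids cut t∈S (inj₂ refl)) ,
    (λ r → cuts cut refl refl (map-Reach (λ e → e , ¬joins e) (λ v∈ → v∈) r))
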